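{- Let $p$ be an odd prime and $M$ the sub-add move matrix. (a) If $p\equiv3\pmod8$ or $p\equiv7\pmod8$, then $\Gamma_{M,\,p}$ has no secondary cycles. (b) If $p\equiv5\pmod8$, then $\Gamma_{M,\,p}$ has secondary cycles.
   Context: The sub-add move matrix is $M=\begin{pmatrix}1&-1\\1&1\end{pmatrix}$. $\Gamma_{M,\,p}$ is the directed graph with vertex set $\mathbb Z_p^2$ and arcs $((a,b),(a-b,a+b))$ (mod $p$; loops allowed). Let $k$ be the $\mathbb Z_p$-order of $M$ (least positive integer with $M^k\equiv I\pmod p$; it equals $4t$ with $t$ the multiplicative order of $-4$ in $GF(p)$). A directed cycle is a cycle in the underlying undirected graph such that in the induced directed subgraph every vertex has in- and out-degree $1$; a loop is a directed $1$-cycle. A primary cycle is a directed cycle of length $k$; a secondary cycle is a directed cycle that is neither primary nor a $1$-cycle. -}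

module Defs where

open import Data.Fin using (Fin; toℕ)
open import Data.Fin.Patterns using (0F; 1F)
open import Data.Integer using (ℤ; +_; -_; 0ℤ; 1ℤ; _+_; _*_; _-_)
open import Data.Integer.Divisibility using (_∣_)
open import Data.Nat using (ℕ; zero; suc; NonZero; _≤_; _<_)
open import Data.Nat.DivMod using (_mod_)
open import Data.Product using (∃; ∃!; _×_; _,_)
open import Data.Vec.Functional using (Vector; []; _∷_)
open import Function.Definitions using (Injective)
open import Level using (0ℓ)
open import Relation.Binary.Construct.Closure.Symmetric using (SymClosure)
open import Relation.Binary.Core using (Rel)
open import Relation.Binary.PropositionalEquality using (_≡_; _≢_)
open import Relation.Nullary using (¬_)

infix 4 _≡_[mod_] _≡ᴹ_[mod_]

_≡_[mod_] : ℤ → ℤ → ℕ → Set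
x ≡ y [mod p ] = + p ∣ x - y

Mat₂ : Set
Mat₂ = Vector (Vector ℤ 2) 2

infixl 7 _⊗_
infixr 8 _^ᴹ_

_⊗_ : Mat₂ → Mat₂ → Mat₂
(A ⊗ B) i j = A i 0F * B 0F j + A i 1F * B 1F j

I₂ : Mat₂
I₂ = (1ℤ ∷ 0ℤ ∷ []) ∷ (0ℤ ∷ 1ℤ ∷ []) ∷ []

_^ᴹ_ : Mat₂ → ℕ → Mat₂
A ^ᴹ zero  = I₂
A ^ᴹ suc n = A ⊗ A ^ᴹ n

M : Mat₂
M = (1ℤ ∷ - 1ℤ ∷ []) ∷ (1ℤ ∷ 1ℤ ∷ []) ∷ []

_≡ᴹ_[mod_] : Mat₂ → Mat₂ → ℕ → Set
A ≡ᴹ B [mod p ] = ∀ i j → A i j ≡ B i j [mod p ]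

record IsOrder (p : ℕ) (A : Mat₂) (k : ℕ) : Set where
  field
    positive : 0 < k
    power≡I  : A ^ᴹ k ≡ᴹ I₂ [mod p ]
    least    : ∀ j → 0 < j → A ^ᴹ j ≡ᴹ I₂ [mod p ] → k ≤ j

-- Vertices of Γ are pairs of residues, each represented in {0,…,p-1}.
Vertex : ℕ → Set
Vertex p = Fin p × Fin p

ΓArc : (p : ℕ) → Rel (Vertex p) 0ℓ
ΓArc p (a , b) (c , d) =
  (+ toℕ c ≡ + toℕ a - + toℕ b [mod p ]) ×
  (+ toℕ d ≡ + toℕ a + + toℕ b [mod p ])

next : ∀ {ℓ} .{{_ : NonZero ℓ}} → Fin ℓ → Fin ℓ
next {ℓ} i = suc (toℕ i) mod ℓ

-- A directed cycle v₀, …, v_{ℓ-1} of length ℓ ≥ 1 in an arbitrary digraph.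
-- Degrees are those in the subgraph induced on {v₀, …, v_{ℓ-1}}; as the vᵢ are
-- distinct, degree 1 means that exactly one index gives a neighbour.  Lengths 1
-- and 2 are allowed.  A length-1 cycle is a loop.  For ℓ = 2 the degree
-- conditions leave exactly the opposite arcs v₀ → v₁ and v₁ → v₀ (and no loops),
-- i.e. two parallel edges of the underlying undirected multigraph.
record DirectedCycle {V : Set} (_⟶_ : Rel V 0ℓ) (ℓ : ℕ) : Set where
  field
    {{ℓ≢0}}   : NonZero ℓ
    vertex    : Fin ℓ → V
    distinct  : Injective _≡_ _≡_ vertex
    adjacent  : ∀ i → SymClosure _⟶_ (vertex i) (vertex (next i))
    inDegree  : ∀ i → ∃! _≡_ λ j → vertex j ⟶ vertex i
    outDegree : ∀ i → ∃! _≡_ λ j → vertex i ⟶ vertex j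

-- Being primary or secondary depends on a directed cycle only through its length.
PrimaryLength : (p ℓ : ℕ) → Set
PrimaryLength p ℓ = IsOrder p M ℓ

HasSecondaryCycle : ℕ → Set
HasSecondaryCycle p =
  ∃ λ ℓ → DirectedCycle (ΓArc p) ℓ × ¬ PrimaryLength p ℓ × ℓ ≢ 1

{-# OPTIONS --safe #-}
-- On ℤ_p² the matrix M acts as multiplication by 1 + i on a + bi, and a directed cycle of Γ
-- is the orbit of a vertex v, of length the least n > 0 with Mⁿ v = v.
--
-- (a) Mⁿ − I = [[a, −b], [b, a]], so a vector v ≠ 0 that it kills forces a² + b² ≡ 0 (mod p),
-- whence a ≡ b ≡ 0 because −1 is not a square modulo p ≡ 3 (mod 4): every cycle other than the
-- loop at the origin has length the order of M.
--
-- (b) Let p = 4q + 1 with q = 2m + 1.  Comparing 2 · 4 ⋯ 4q with (2q)! gives 2^2q ≡ (−1)^q = −1,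
-- so c = (−1)^m 2^q satisfies c² ≡ −1, and (1 ∓ c)^2q = (∓2c)^q ≡ ±1.  As (1, c) and (1, −c) are
-- eigenvectors of M for 1 − c and 1 + c, the orbit of (1, c) has length dividing 2q, which the
-- order of M does not.
module Submission where

open import Defs
open import Algebra using (CommutativeRing)
import Algebra.Properties.CommutativeSemiring.Exp as Exp
open import Data.Fin as Fin using (Fin; toℕ; fromℕ<)
open import Data.Fin.Patterns using (0F; 1F)
import Data.Fin.Properties as Fin
open import Data.Integer.DivMod using (n%ℕd<d; a≡a%ℕn+[a/ℕn]*n; _%ℕ_; _/ℕ_)
import Data.Integer.Divisibility.Signed as Signed
import Data.Integer.Properties as ℤ
open import Data.Integer.Tactic.RingSolver using (solve-∀)
import Data.Nat as ℕ
open import Data.Nat using (ℕ; zero; suc; _%_; _/_; _!)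
open import Data.Nat.Coprimality using (prime⇒coprime; coprime-Bézout)
import Data.Nat.Divisibility as ℕ
open import Data.Nat.Divisibility using (_∣_; divides)
open import Data.Nat.DivMod using (m≡m%n+[m/n]*n; m∣n⇒o%n%m≡o%m; m%n≤m)
open import Data.Nat.GCD using (module Bézout)
open import Data.Nat.GeneralisedArithmetic using (fold; fold-+)
open import Data.Nat.Primality using (Prime; prime⇒nonZero; prime⇒nonTrivial; euclidsLemma)
import Data.Nat.Properties as ℕ
import Data.Nat.Tactic.RingSolver as ℕSolver
open import Data.Product using (_×_; _,_; ∃; proj₁; proj₂)
open import Data.Product.Properties using (≡-dec)
open import Data.Sum as Sum using (_⊎_; inj₁; inj₂; [_,_]′)
open import Data.Vec.Functional using (Vector; []; _∷_)
open import Function using (_$_; _∘_; id)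
open import Level using (0ℓ)
open import Relation.Binary using (Rel; DecidableEquality; IsEquivalence; tri<; tri≈; tri>)
open import Relation.Binary.Construct.Closure.Symmetric using (fwd; bwd)
open import Relation.Binary.PropositionalEquality using (_≡_; _≢_; refl; sym; trans; cong; cong₂; subst; module ≡-Reasoning)
import Relation.Binary.Reasoning.Setoid as SetoidReasoning
open import Relation.Nullary using (¬_; Dec; yes; no; contradiction; _×-dec_)
open import Relation.Nullary.Decidable using (from-yes; _→-dec_; _⊎-dec_)
open import Relation.Unary using (Pred; Decidable)

-- Cycles of functional digraphs

module FunctionalDigraphs where
  open import Data.Nat using (_+_; _*_; _∸_; _<_; _≤_; _≤?_; s≤s; NonZero; >-nonZero; >-nonZero⁻¹)
  open import Data.Nat.Divisibility using (∣⇒≤; m%n≡0⇒n∣m; ∣m+n∣m⇒∣n; n∣m*n)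
  open import Data.Nat.DivMod using ([m+kn]%n≡m%n; _mod_; m%n<n; m<n⇒m%n≡m; %-distribˡ-+; m%n%n≡m%n)
  open import Data.Nat.Induction using (<-rec)
  open import Data.Nat.Properties

  least : ∀ {P : Pred ℕ 0ℓ} → Decidable P → ∀ n → P n → ∃ λ m → P m × (∀ j → P j → m ≤ j)
  least {P} P? = <-rec _ go
    where
    go : ∀ n → (∀ {m} → m < n → P m → ∃ λ k → P k × (∀ j → P j → k ≤ j)) →
         P n → ∃ λ k → P k × (∀ j → P j → k ≤ j)
    go n rec pn with anyUpTo? P? n
    ... | yes (m , m<n , pm) = rec m<n pm
    ... | no  none           = n , pn , λ j pj → ≮⇒≥ λ j<n → none (j , j<n , pj)

  next-mod : ∀ n ℓ .{{_ : NonZero ℓ}} → next (n mod ℓ) ≡ suc n mod ℓ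
  next-mod n ℓ = Fin.toℕ-injective $ begin
    toℕ (next (n mod ℓ))     ≡⟨ Fin.toℕ-fromℕ< _ ⟩
    suc (toℕ (n mod ℓ)) % ℓ  ≡⟨ cong (λ k → suc k % ℓ) (Fin.toℕ-fromℕ< _) ⟩
    suc (n % ℓ) % ℓ          ≡⟨ %-distribˡ-+ 1 (n % ℓ) ℓ ⟩
    (1 % ℓ + n % ℓ % ℓ) % ℓ  ≡⟨ cong (λ k → (1 % ℓ + k) % ℓ) (m%n%n≡m%n n ℓ) ⟩
    (1 % ℓ + n % ℓ) % ℓ      ≡⟨ %-distribˡ-+ 1 n ℓ ⟨
    suc n % ℓ                ≡⟨ Fin.toℕ-fromℕ< _ ⟨
    toℕ (suc n mod ℓ)        ∎
    where open ≡-Reasoning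

  toℕ-mod : ∀ {ℓ} .{{_ : NonZero ℓ}} (i : Fin ℓ) → toℕ i mod ℓ ≡ i
  toℕ-mod {ℓ} i = Fin.toℕ-injective (trans (Fin.toℕ-fromℕ< _) (m<n⇒m%n≡m (Fin.toℕ<n i)))

  mod-injective : ∀ m n ℓ .{{_ : NonZero ℓ}} → m mod ℓ ≡ n mod ℓ → m % ℓ ≡ n % ℓ
  mod-injective m n ℓ eq = Fin.fromℕ<-injective _ _ _ _ eq

  -- `k + n` and `n` are the same remainder plus multiples of `ℓ`, so `k` is a difference of two
  -- multiples; `∣m+n∣m⇒∣n` expresses this without subtraction.
  %-cancelʳ : ∀ k n ℓ .{{_ : NonZero ℓ}} → (k + n) % ℓ ≡ n % ℓ → ℓ ∣ k
  %-cancelʳ k n ℓ eq = ∣m+n∣m⇒∣n {m = n / ℓ * ℓ} (subst (ℓ ∣_) shift (n∣m*n ((k + n) / ℓ))) (n∣m*n (n / ℓ))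
    where
    open ≡-Reasoning
    shift : (k + n) / ℓ * ℓ ≡ n / ℓ * ℓ + k
    shift = +-cancelˡ-≡ (n % ℓ) _ _ $ begin
      n % ℓ + (k + n) / ℓ * ℓ        ≡⟨ cong (_+ (k + n) / ℓ * ℓ) eq ⟨
      (k + n) % ℓ + (k + n) / ℓ * ℓ  ≡⟨ m≡m%n+[m/n]*n (k + n) ℓ ⟨
      k + n                          ≡⟨ +-comm k n ⟩
      n + k                          ≡⟨ cong (_+ k) (m≡m%n+[m/n]*n n ℓ) ⟩
      n % ℓ + n / ℓ * ℓ + k          ≡⟨ +-assoc (n % ℓ) _ k ⟩
      n % ℓ + (n / ℓ * ℓ + k)        ∎

  self-or-next : ∀ {ℓ} .{{_ : NonZero ℓ}} → ℓ ≤ 2 → (i j : Fin ℓ) → j ≡ i ⊎ j ≡ next i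
  self-or-next {1} _ 0F 0F = inj₁ refl
  self-or-next {2} _ 0F 0F = inj₁ refl
  self-or-next {2} _ 0F 1F = inj₂ refl
  self-or-next {2} _ 1F 0F = inj₂ refl
  self-or-next {2} _ 1F 1F = inj₁ refl
  self-or-next {suc (suc (suc _))} (s≤s (s≤s ())) _ _

  record MinimalPeriod {V : Set} (f : V → V) (v : V) (ℓ : ℕ) : Set where
    field
      positive : 0 < ℓ
      period   : fold v f ℓ ≡ v
      minimal  : ∀ j → 0 < j → fold v f j ≡ v → ℓ ≤ j

  module _ {V : Set} {f : V → V} {v : V} where

    fold-multiple : ∀ {ℓ} k → fold v f ℓ ≡ v → fold v f (k * ℓ) ≡ v
    fold-multiple         zero    per = refl
    fold-multiple {ℓ} (suc k) per = begin
      fold v f (ℓ + k * ℓ)         ≡⟨ fold-+ v f ℓ ⟩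
      fold (fold v f (k * ℓ)) f ℓ  ≡⟨ cong (λ u → fold u f ℓ) (fold-multiple k per) ⟩
      fold v f ℓ                   ≡⟨ per ⟩
      v                            ∎
      where open ≡-Reasoning

    fold-% : ∀ {ℓ} .{{_ : NonZero ℓ}} n → fold v f ℓ ≡ v → fold v f (n % ℓ) ≡ fold v f n
    fold-% {ℓ} n per = begin
      fold v f (n % ℓ)                       ≡⟨ cong (λ u → fold u f (n % ℓ)) (fold-multiple (n / ℓ) per) ⟨
      fold (fold v f (n / ℓ * ℓ)) f (n % ℓ)  ≡⟨ fold-+ v f (n % ℓ) ⟨
      fold v f (n % ℓ + n / ℓ * ℓ)           ≡⟨ cong (fold v f) (m≡m%n+[m/n]*n n ℓ) ⟨
      fold v f n                             ∎
      where open ≡-Reasoning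

    minimalPeriod-exists : DecidableEquality V → ∀ n → 0 < n → fold v f n ≡ v →
                           ∃ λ ℓ → MinimalPeriod f v ℓ
    minimalPeriod-exists _≟ⱽ_ n 0<n per
      with least (λ j → (1 ≤? j) ×-dec (fold v f j ≟ⱽ v)) n (0<n , per)
    ... | ℓ , (0<ℓ , perℓ) , min = ℓ , record
      { positive = 0<ℓ
      ; period   = perℓ
      ; minimal  = λ j 0<j perj → min j (0<j , perj)
      }

    minimalPeriod-∣ : ∀ {ℓ n} → MinimalPeriod f v ℓ → fold v f n ≡ v → ℓ ∣ n
    minimalPeriod-∣ {ℓ} {n} mp per = m%n≡0⇒n∣m n ℓ (n≤0⇒n≡0 (≮⇒≥ λ 0<r →
      <⇒≱ (m%n<n n ℓ) (minimal (n % ℓ) 0<r (trans (fold-% n period) per))))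
      where
      open MinimalPeriod mp
      instance _ = >-nonZero positive

  module _ {V : Set} {f : V → V} {_⟶_ : Rel V 0ℓ}
           (arc⇒≡ : ∀ u w → u ⟶ w → f u ≡ w) (arc : ∀ u → u ⟶ f u) where

    -- `f` may merge vertices elsewhere in `V`, but on a periodic orbit its `(ℓ ∸ 1)`-st iterate
    -- inverts it. This yields in-degree 1.
    minimalPeriod⇒cycle : ∀ {v ℓ} → MinimalPeriod f v ℓ → DirectedCycle _⟶_ ℓ
    minimalPeriod⇒cycle {v} {ℓ} mp = record
      { vertex    = vertex
      ; distinct  = distinct
      ; adjacent  = λ i → fwd (step i)
      ; inDegree  = λ i → prev i , arc-from-prev i , λ {j} a → distinct (sym (prev-unique i j (arc⇒≡ _ _ a)))
      ; outDegree = λ i → next i , step i , λ {j} a → distinct (trans (sym (arc⇒≡ _ _ (step i))) (arc⇒≡ _ _ a))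
      }
      where
      open MinimalPeriod mp
      open ≡-Reasoning
      instance _ = >-nonZero positive

      vertex : Fin ℓ → V
      vertex i = fold v f (toℕ i)

      vertex-mod : ∀ n → vertex (n mod ℓ) ≡ fold v f n
      vertex-mod n = trans (cong (fold v f) (Fin.toℕ-fromℕ< (m%n<n n ℓ))) (fold-% n period)

      step : ∀ i → vertex i ⟶ vertex (next i)
      step i = subst (vertex i ⟶_) (sym (vertex-mod (suc (toℕ i)))) (arc (vertex i))

      -- Applying f another ℓ ∸ j times to f^i v = f^j v returns to v too early.
      no-collision : ∀ {i j} → i < j → j < ℓ → fold v f i ≢ fold v f j
      no-collision {i} {j} i<j j<ℓ eq = <⇒≱ shorter (minimal (ℓ ∸ j + i) (<-≤-trans (m<n⇒0<n∸m j<ℓ) (m≤m+n _ i)) (begin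
        fold v f (ℓ ∸ j + i)         ≡⟨ fold-+ v f (ℓ ∸ j) ⟩
        fold (fold v f i) f (ℓ ∸ j)  ≡⟨ cong (λ u → fold u f (ℓ ∸ j)) eq ⟩
        fold (fold v f j) f (ℓ ∸ j)  ≡⟨ fold-+ v f (ℓ ∸ j) ⟨
        fold v f (ℓ ∸ j + j)         ≡⟨ cong (fold v f) (m∸n+n≡m (<⇒≤ j<ℓ)) ⟩
        fold v f ℓ                   ≡⟨ period ⟩
        v                            ∎))
        where
        shorter : ℓ ∸ j + i < ℓ
        shorter = <-≤-trans (+-monoʳ-< (ℓ ∸ j) i<j) (≤-reflexive (m∸n+n≡m (<⇒≤ j<ℓ)))

      distinct : ∀ {i j} → vertex i ≡ vertex j → i ≡ j
      distinct {i} {j} eq with Fin.<-cmp i j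
      ... | tri< i<j _ _ = contradiction eq (no-collision i<j (Fin.toℕ<n j))
      ... | tri≈ _ i≡j _ = i≡j
      ... | tri> _ _ j<i = contradiction (sym eq) (no-collision j<i (Fin.toℕ<n i))

      prev : Fin ℓ → Fin ℓ
      -- Adding `ℓ ∸ 1` stands for subtracting 1, so that index 0 wraps around to the last vertex.
      prev i = (ℓ ∸ 1 + toℕ i) mod ℓ

      1+[ℓ∸1]≡ℓ : suc (ℓ ∸ 1) ≡ ℓ
      1+[ℓ∸1]≡ℓ = m+[n∸m]≡n positive

      fold-ℓ+ : ∀ n → fold v f (ℓ + n) ≡ fold v f n
      fold-ℓ+ n = begin
        fold v f (ℓ + n)       ≡⟨ cong (fold v f) (+-comm ℓ n) ⟩
        fold v f (n + ℓ)       ≡⟨ fold-+ v f n ⟩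
        fold (fold v f ℓ) f n  ≡⟨ cong (λ u → fold u f n) period ⟩
        fold v f n             ∎

      arc-from-prev : ∀ i → vertex (prev i) ⟶ vertex i
      arc-from-prev i = subst (vertex (prev i) ⟶_) (begin
        f (vertex (prev i))             ≡⟨ cong f (vertex-mod (ℓ ∸ 1 + toℕ i)) ⟩
        fold v f (suc (ℓ ∸ 1) + toℕ i)  ≡⟨ cong (λ k → fold v f (k + toℕ i)) 1+[ℓ∸1]≡ℓ ⟩
        fold v f (ℓ + toℕ i)            ≡⟨ fold-ℓ+ (toℕ i) ⟩
        vertex i                        ∎) (arc (vertex (prev i)))

      prev-unique : ∀ i j → f (vertex j) ≡ vertex i → vertex j ≡ vertex (prev i)
      prev-unique i j eq = begin
        vertex j                        ≡⟨ fold-ℓ+ (toℕ j) ⟨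
        fold v f (ℓ + toℕ j)            ≡⟨ cong (λ k → fold v f (k + toℕ j)) (trans (sym 1+[ℓ∸1]≡ℓ) (+-comm 1 (ℓ ∸ 1))) ⟩
        fold v f (ℓ ∸ 1 + 1 + toℕ j)    ≡⟨ cong (fold v f) (+-assoc (ℓ ∸ 1) 1 (toℕ j)) ⟩
        fold v f (ℓ ∸ 1 + suc (toℕ j))  ≡⟨ fold-+ v f (ℓ ∸ 1) ⟩
        fold (f (vertex j)) f (ℓ ∸ 1)   ≡⟨ cong (λ u → fold u f (ℓ ∸ 1)) eq ⟩
        fold (vertex i) f (ℓ ∸ 1)       ≡⟨ fold-+ v f (ℓ ∸ 1) ⟨
        fold v f (ℓ ∸ 1 + toℕ i)        ≡⟨ vertex-mod (ℓ ∸ 1 + toℕ i) ⟨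
        vertex (prev i)                 ∎

    module _ {ℓ} (C : DirectedCycle _⟶_ ℓ) where
      open DirectedCycle C
      open ≡-Reasoning

      -- `adjacent` leaves the direction of each edge open. The degree conditions force one
      -- direction throughout, and a cycle listed backwards is still an orbit of `f`.
      Forward Backward : Fin ℓ → Set
      Forward  i = f (vertex i) ≡ vertex (next i)
      Backward i = f (vertex (next i)) ≡ vertex i

      forward-or-backward : ∀ i → Forward i ⊎ Backward i
      forward-or-backward i with adjacent i
      ... | fwd a = inj₁ (arc⇒≡ _ _ a)
      ... | bwd a = inj₂ (arc⇒≡ _ _ a)

      predecessor-unique : ∀ {i j k} → f (vertex i) ≡ vertex k → f (vertex j) ≡ vertex k → i ≡ j
      predecessor-unique {i} {j} {k} eqi eqj =
        let (_ , _ , unique) = inDegree k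
        in trans (sym (unique (subst (vertex i ⟶_) eqi (arc _))))
                 (unique (subst (vertex j ⟶_) eqj (arc _)))

      -- The out-neighbour of `i` is `next i` or `i` itself. In the latter case, if the edge to
      -- `next i` is not forward, then `i` and `next i` are both predecessors of `i` and in-degree 1
      -- identifies them.
      forward-short : ℓ ≤ 2 → ∀ i → Forward i
      forward-short ℓ≤2 i with outDegree i
      ... | j , a , _ with self-or-next ℓ≤2 i j
      ... | inj₂ refl = arc⇒≡ _ _ a
      ... | inj₁ refl with forward-or-backward i
      ... | inj₁ fw = fw
      ... | inj₂ bw = trans (arc⇒≡ _ _ a) (cong vertex (predecessor-unique (arc⇒≡ _ _ a) bw))

      next²≢ : 2 < ℓ → ∀ i → next (next i) ≢ i
      next²≢ 2<ℓ i eq = <⇒≱ 2<ℓ (∣⇒≤ (%-cancelʳ 2 (toℕ i) ℓ (mod-injective (2 + toℕ i) (toℕ i) ℓ (begin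
        (2 + toℕ i) mod ℓ  ≡⟨ next-mod (1 + toℕ i) ℓ ⟨
        next (next i)      ≡⟨ eq ⟩
        i                  ≡⟨ toℕ-mod i ⟨
        toℕ i mod ℓ        ∎))))

      -- A change of direction would give the vertex at `next i` the two predecessors `i` and
      -- `next (next i)`, which differ once `ℓ` exceeds 2.
      forward-next : 2 < ℓ → ∀ i → Forward i → Forward (next i)
      forward-next 2<ℓ i fw with forward-or-backward (next i)
      ... | inj₁ fw′ = fw′
      ... | inj₂ bw  = contradiction (predecessor-unique bw fw) (next²≢ 2<ℓ i)

      -- Here a change of direction would give the vertex at `next i` two different images under
      -- `f`.
      backward-next : 2 < ℓ → ∀ i → Backward i → Backward (next i)
      backward-next 2<ℓ i bw with forward-or-backward (next i)
      ... | inj₂ bw′ = bw′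
      ... | inj₁ fw  = contradiction (distinct (trans (sym fw) bw)) (next²≢ 2<ℓ i)

      -- Natural-number indices, read modulo `ℓ`, can be compared directly with iteration counts of
      -- `f`.
      w : ℕ → V
      w n = vertex (n mod ℓ)

      w-injective : ∀ k n → w (k + n) ≡ w n → ℓ ∣ k
      w-injective k n eq = %-cancelʳ k n ℓ (mod-injective (k + n) n ℓ (distinct eq))

      along-or-against : (∀ n → f (w n) ≡ w (suc n)) ⊎ (∀ n → f (w (suc n)) ≡ w n)
      along-or-against = Sum.map
        (λ all n → trans (all n) (cong vertex (next-mod n ℓ)))
        (λ all n → trans (cong (f ∘ vertex) (sym (next-mod n ℓ))) (all n))
        uniform
        where
        spread : ∀ (P : Fin ℓ → Set) → (∀ i → P i → P (next i)) → P (0 mod ℓ) → ∀ n → P (n mod ℓ)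
        spread P step p₀ zero    = p₀
        spread P step p₀ (suc n) = subst P (next-mod n ℓ) (step _ (spread P step p₀ n))

        uniform : (∀ n → Forward (n mod ℓ)) ⊎ (∀ n → Backward (n mod ℓ))
        -- For `ℓ ≤ 2` the indices `i` and `next (next i)` coincide, so directions do not propagate;
        -- there each edge is shown to be forward separately.
        uniform with ℓ ≤? 2
        ... | yes ℓ≤2 = inj₁ λ n → forward-short ℓ≤2 (n mod ℓ)
        ... | no  ℓ≰2 = Sum.map (spread Forward (forward-next (≰⇒> ℓ≰2))) (spread Backward (backward-next (≰⇒> ℓ≰2)))
                          (forward-or-backward (0 mod ℓ))

      w-multiple : ∀ k → w (k * ℓ) ≡ w 0
      w-multiple k = cong vertex (Fin.fromℕ<-cong _ _ ([m+kn]%n≡m%n 0 k ℓ) _ _)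

      fold-along : (∀ n → f (w n) ≡ w (suc n)) → ∀ n → fold (w 0) f n ≡ w n
      fold-along along zero    = refl
      fold-along along (suc n) = trans (cong f (fold-along along n)) (along n)

      fold-against : (∀ n → f (w (suc n)) ≡ w n) → ∀ k n → fold (w (k + n)) f k ≡ w n
      fold-against against zero    n = refl
      fold-against against (suc k) n = begin
        f (fold (w (suc (k + n))) f k)  ≡⟨ cong (λ m → f (fold (w m) f k)) (+-suc k n) ⟨
        f (fold (w (k + suc n)) f k)    ≡⟨ cong f (fold-against against k (suc n)) ⟩
        f (w (suc n))                   ≡⟨ against n ⟩
        w n                             ∎

      -- Listed against the arcs, the cycle is the orbit of `w 0` in reverse order, so both
      -- directions give the same length. Minimality follows because `ℓ` divides every period.
      cycle⇒minimalPeriod : MinimalPeriod f (w 0) ℓ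
      cycle⇒minimalPeriod = record
        { positive = >-nonZero⁻¹ ℓ
        ; period   = period along-or-against
        ; minimal  = λ j 0<j eq → ∣⇒≤ {{>-nonZero 0<j}} (ℓ∣period j eq along-or-against)
        }
        where
        w-ℓ : w ℓ ≡ w 0
        w-ℓ = trans (cong w (sym (*-identityˡ ℓ))) (w-multiple 1)

        period : (∀ n → f (w n) ≡ w (suc n)) ⊎ (∀ n → f (w (suc n)) ≡ w n) → fold (w 0) f ℓ ≡ w 0
        period (inj₁ along)   = trans (fold-along along ℓ) w-ℓ
        period (inj₂ against) = begin
          fold (w 0) f ℓ        ≡⟨ cong (λ u → fold u f ℓ) w-ℓ ⟨
          fold (w ℓ) f ℓ        ≡⟨ cong (λ n → fold (w n) f ℓ) (+-identityʳ ℓ) ⟨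
          fold (w (ℓ + 0)) f ℓ  ≡⟨ fold-against against ℓ 0 ⟩
          w 0                   ∎

        ℓ∣period : ∀ j → fold (w 0) f j ≡ w 0 →
                   (∀ n → f (w n) ≡ w (suc n)) ⊎ (∀ n → f (w (suc n)) ≡ w n) → ℓ ∣ j
        ℓ∣period j eq (inj₁ along)   = w-injective j 0 (begin
          w (j + 0)       ≡⟨ cong w (+-identityʳ j) ⟩
          w j             ≡⟨ fold-along along j ⟨
          fold (w 0) f j  ≡⟨ eq ⟩
          w 0             ∎)
        ℓ∣period j eq (inj₂ against) = w-injective j n (begin
          w (j + n)             ≡⟨ w-j+n ⟩
          w 0                   ≡⟨ eq ⟨
          fold (w 0) f j        ≡⟨ cong (λ u → fold u f j) w-j+n ⟨
          fold (w (j + n)) f j  ≡⟨ fold-against against j n ⟩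
          w n                   ∎)
          where
          -- This index represents `−j` modulo `ℓ`: `j + n` is `j * ℓ`, so iterating `f` from `w 0`
          -- for `j` steps against the listing ends at `w n`.
          n = j * (ℓ ∸ 1)
          w-j+n : w (j + n) ≡ w 0
          w-j+n = begin
            w (j + n)            ≡⟨ cong w (*-suc j (ℓ ∸ 1)) ⟨
            w (j * suc (ℓ ∸ 1))  ≡⟨ cong (λ k → w (j * k)) (m+[n∸m]≡n (>-nonZero⁻¹ ℓ)) ⟩
            w (j * ℓ)            ≡⟨ w-multiple j ⟩
            w 0                  ∎

-- −1 is not a square modulo n ≡ 3 (mod 4)

module SquaresPlusOne where
  open import Data.Nat using (_+_; _*_; _<_; _≤_; s≤s; _≟_)
  open import Data.Nat.Divisibility using (quotient; m∣n⇒n≡m*quotient; ∣m+n∣m⇒∣n; n∣m*n; ∣-trans)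
  open import Data.Nat.DivMod using ([m+kn]%n≡m%n; _mod_; m%n<n; %-distribˡ-+; %-distribˡ-*)
  open import Data.Nat.Induction using (<-rec)
  open import Data.Nat.Properties hiding (_≟_)

  -- Modulo 8, `1 + x²` is 1, 2 or 5, and `n` is 3 or 7, hence its own inverse; so `m` is 3, 6 or 7.
  -- The 512 triples are checked by decision. Working modulo 8 rather than 4 excludes `m ≡ 2`, whose
  -- half would be 1 modulo 4.
  cofactor-mod-8 : ∀ (n m x : Fin 8) → toℕ n % 4 ≡ 3 → (toℕ n * toℕ m) % 8 ≡ (1 + toℕ x * toℕ x) % 8 →
                   toℕ m % 4 ≡ 3 ⊎ toℕ m ≡ 6
  cofactor-mod-8 = from-yes check
    where
    check : Dec (∀ (n m x : Fin 8) → toℕ n % 4 ≡ 3 → (toℕ n * toℕ m) % 8 ≡ (1 + toℕ x * toℕ x) % 8 →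
                 toℕ m % 4 ≡ 3 ⊎ toℕ m ≡ 6)
    check = Fin.all? λ n → Fin.all? λ m → Fin.all? λ x →
      (toℕ n % 4 ≟ 3) →-dec (((toℕ n * toℕ m) % 8 ≟ (1 + toℕ x * toℕ x) % 8) →-dec
      ((toℕ m % 4 ≟ 3) ⊎-dec (toℕ m ≟ 6)))

  -- `n m` is at most `1 + (n − 1)² = n² − 2 (n − 1)`, which is below `n²` unless `n = 1`.
  cofactor<n : ∀ n m y → n ≢ 1 → y < n → n * m ≡ 1 + y * y → m < n
  cofactor<n n m y n≢1 (s≤s {n = n-1} y≤n-1) eq = ≰⇒> λ n≤m → n≢1 (cong suc (n≤0⇒n≡0
    (+-cancelʳ-≤ (1 + n-1 * n-1) n-1 0 (begin
      n-1 + (1 + n-1 * n-1)        ≤⟨ m≤m+n _ n-1 ⟩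
      n-1 + (1 + n-1 * n-1) + n-1  ≡⟨ square-suc n-1 ⟩
      n * n                        ≤⟨ *-monoʳ-≤ n n≤m ⟩
      n * m                        ≡⟨ eq ⟩
      1 + y * y                    ≤⟨ s≤s (*-mono-≤ y≤n-1 y≤n-1) ⟩
      1 + n-1 * n-1                ∎))))
    where
    open ≤-Reasoning
    square-suc : ∀ k → k + (1 + k * k) + k ≡ suc k * suc k
    square-suc = ℕSolver.solve-∀

  -- Descent: a prime-free version of "−1 is not a square".  After reducing x below n,
  -- the cofactor m of n in 1 + x², halved if even, is smaller than n and again 3 mod 4.
  n≡3[4]⇒n∤1+x² : ∀ n → n % 4 ≡ 3 → ∀ x → ¬ n ∣ 1 + x * x
  n≡3[4]⇒n∤1+x² = <-rec _ go
    where
    open ≡-Reasoning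
    go : ∀ n → (∀ {m} → m < n → m % 4 ≡ 3 → ∀ x → ¬ m ∣ 1 + x * x) →
         n % 4 ≡ 3 → ∀ x → ¬ n ∣ 1 + x * x
    go n@(suc _) rec n≡3 x n∣1+x² = [ m≡3⇒⊥ , m≡6⇒⊥ ]′ m-residue
      where
      y = x % n

      reduce : ∀ y k n → 1 + (y + k * n) * (y + k * n) ≡ k * (y + y + k * n) * n + (1 + y * y)
      reduce = ℕSolver.solve-∀

      n∣1+y² : n ∣ 1 + y * y
      n∣1+y² = ∣m+n∣m⇒∣n
        (subst (n ∣_) (trans (cong (λ z → 1 + z * z) (m≡m%n+[m/n]*n x n)) (reduce y (x / n) n)) n∣1+x²)
        (n∣m*n (x / n * (y + y + x / n * n)))

      m = quotient n∣1+y²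

      eq : n * m ≡ 1 + y * y
      eq = sym (m∣n⇒n≡m*quotient n∣1+y²)

      m<n : m < n
      m<n = cofactor<n n m y (λ { refl → contradiction n≡3 λ () }) (m%n<n x n) eq

      toℕ-mod-8 : ∀ k → toℕ (k mod 8) ≡ k % 8
      toℕ-mod-8 k = Fin.toℕ-fromℕ< (m%n<n k 8)

      m-residue : m % 4 ≡ 3 ⊎ m % 8 ≡ 6
      m-residue = Sum.map
        (trans (sym (trans (cong (_% 4) (toℕ-mod-8 m)) (m∣n⇒o%n%m≡o%m 4 8 m (divides 2 refl)))))
        (trans (sym (toℕ-mod-8 m)))
        (cofactor-mod-8 (n mod 8) (m mod 8) (y mod 8)
          (trans (trans (cong (_% 4) (toℕ-mod-8 n)) (m∣n⇒o%n%m≡o%m 4 8 n (divides 2 refl))) n≡3)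
          (begin
            (toℕ (n mod 8) * toℕ (m mod 8)) % 8      ≡⟨ cong₂ (λ a b → (a * b) % 8) (toℕ-mod-8 n) (toℕ-mod-8 m) ⟩
            (n % 8 * (m % 8)) % 8                    ≡⟨ %-distribˡ-* n m 8 ⟨
            (n * m) % 8                              ≡⟨ cong (_% 8) eq ⟩
            (1 + y * y) % 8                          ≡⟨ %-distribˡ-+ 1 (y * y) 8 ⟩
            (1 + (y * y) % 8) % 8                    ≡⟨ cong (λ k → (1 + k) % 8) (%-distribˡ-* y y 8) ⟩
            (1 + (y % 8 * (y % 8)) % 8) % 8          ≡⟨ %-distribˡ-+ 1 (y % 8 * (y % 8)) 8 ⟨
            (1 + y % 8 * (y % 8)) % 8                ≡⟨ cong (λ k → (1 + k * k) % 8) (toℕ-mod-8 y) ⟨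
            (1 + toℕ (y mod 8) * toℕ (y mod 8)) % 8  ∎))

      m≡3⇒⊥ : ¬ m % 4 ≡ 3
      m≡3⇒⊥ m≡3 = rec m<n m≡3 y (divides n (sym eq))

      m≡6⇒⊥ : ¬ m % 8 ≡ 6
      m≡6⇒⊥ m≡6 = rec (≤-<-trans h≤m m<n) ([m+kn]%n≡m%n 3 (m / 8) 4) y (∣-trans h∣m (divides n (sym eq)))
        where
        -- Half of `m = 6 + 8 (m / 8)`.
        h = 3 + m / 8 * 4
        double : ∀ k → 6 + k * 8 ≡ 2 * (3 + k * 4)
        double = ℕSolver.solve-∀
        m≡2h : m ≡ 2 * h
        m≡2h = trans (trans (m≡m%n+[m/n]*n m 8) (cong (_+ m / 8 * 8) m≡6)) (double (m / 8))
        h∣m : h ∣ m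
        h∣m = divides 2 m≡2h
        h≤m : h ≤ m
        h≤m = subst (h ≤_) (sym m≡2h) (m≤m+n h (h + 0))

-- Arithmetic modulo p

open import Data.Integer using (ℤ; +_; 0ℤ; 1ℤ; ∣_∣; _+_; _*_; _-_; -_)

module Residues (p : ℕ) where

  infix 4 _≈_

  -- A record, because `_≡_[mod_]` unfolds to divisibility of `∣ x - y ∣`, from which `x` and `y`
  -- cannot be inferred. Signed divisibility lets witnesses be combined linearly.
  record _≈_ (x y : ℤ) : Set where
    constructor mod-p
    field p∣x-y : + p Signed.∣ x - y

  ≈⇒[mod] : ∀ {x y} → x ≈ y → x ≡ y [mod p ]
  ≈⇒[mod] (mod-p d) = Signed.∣⇒∣ᵤ d

  [mod]⇒≈ : ∀ {x y} → x ≡ y [mod p ] → x ≈ y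
  [mod]⇒≈ {x} {y} d = mod-p (Signed.∣ᵤ⇒∣ {+ p} {x - y} d)

  _≈?_ : ∀ x y → Dec (x ≈ y)
  x ≈? y with + p Signed.∣? x - y
  ... | yes d = yes (mod-p d)
  ... | no ¬d = no λ { (mod-p d) → ¬d d }

  ≡⇒≈ : ∀ {x y} → x ≡ y → x ≈ y
  ≡⇒≈ {x} refl = mod-p (Signed.divides 0ℤ (ℤ.+-inverseʳ x))

  -- The pattern behind most congruences below: an exact identity over ℤ, left to the ring solver,
  -- writes the wanted difference as a linear combination of the given ones.
  combine : ∀ {x y u v} k → x - y ≡ k * (u - v) → u ≈ v → x ≈ y
  combine k eq (mod-p d) = mod-p (subst (+ p Signed.∣_) (sym eq) (Signed.∣n⇒∣m*n k d))

  combine₂ : ∀ {x y u v u′ v′} k k′ → x - y ≡ k * (u - v) + k′ * (u′ - v′) →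
             u ≈ v → u′ ≈ v′ → x ≈ y
  combine₂ k k′ eq (mod-p d) (mod-p d′) =
    mod-p (subst (+ p Signed.∣_) (sym eq) (Signed.∣m∣n⇒∣m+n (Signed.∣n⇒∣m*n k d) (Signed.∣n⇒∣m*n k′ d′)))

  ≈-isEquivalence : IsEquivalence _≈_
  ≈-isEquivalence = record
    { refl  = ≡⇒≈ refl
    ; sym   = λ {x} {y} → combine (- 1ℤ) (swap x y)
    ; trans = λ {x} {y} {z} → combine₂ 1ℤ 1ℤ (chain x y z)
    }
    where
    swap : ∀ x y → y - x ≡ - 1ℤ * (x - y)
    swap = solve-∀
    chain : ∀ x y z → x - z ≡ 1ℤ * (x - y) + 1ℤ * (y - z)
    chain = solve-∀

  ℤ/p : CommutativeRing 0ℓ 0ℓ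
  ℤ/p = record
    { Carrier = ℤ ; _≈_ = _≈_ ; _+_ = _+_ ; _*_ = _*_ ; -_ = -_ ; 0# = 0ℤ ; 1# = 1ℤ
    ; isCommutativeRing = record
      { isRing = record
        { +-isAbelianGroup = record
          { isGroup = record
            { isMonoid = record
              { isSemigroup = record
                { isMagma = record
                  { isEquivalence = ≈-isEquivalence
                  ; ∙-cong = λ {x} {y} {u} {v} → combine₂ 1ℤ 1ℤ (+-cong-≡ x y u v)
                  }
                ; assoc = λ x y z → ≡⇒≈ (ℤ.+-assoc x y z)
                }
              ; identity = (λ x → ≡⇒≈ (ℤ.+-identityˡ x)) , (λ x → ≡⇒≈ (ℤ.+-identityʳ x))
              }
            ; inverse = (λ x → ≡⇒≈ (ℤ.+-inverseˡ x)) , (λ x → ≡⇒≈ (ℤ.+-inverseʳ x))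
            ; ⁻¹-cong = λ {x} {y} → combine (- 1ℤ) (neg-cong-≡ x y)
            }
          ; comm = λ x y → ≡⇒≈ (ℤ.+-comm x y)
          }
        ; *-cong = λ {x} {y} {u} {v} → combine₂ u y (*-cong-≡ x y u v)
        ; *-assoc = λ x y z → ≡⇒≈ (ℤ.*-assoc x y z)
        ; *-identity = (λ x → ≡⇒≈ (ℤ.*-identityˡ x)) , (λ x → ≡⇒≈ (ℤ.*-identityʳ x))
        ; distrib = (λ x y z → ≡⇒≈ (ℤ.*-distribˡ-+ x y z)) , (λ x y z → ≡⇒≈ (ℤ.*-distribʳ-+ x y z))
        }
      ; *-comm = λ x y → ≡⇒≈ (ℤ.*-comm x y)
      }
    }
    where
    +-cong-≡ : ∀ x y u v → (x + u) - (y + v) ≡ 1ℤ * (x - y) + 1ℤ * (u - v)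
    +-cong-≡ = solve-∀
    neg-cong-≡ : ∀ x y → - x - - y ≡ - 1ℤ * (x - y)
    neg-cong-≡ = solve-∀
    *-cong-≡ : ∀ x y u v → (x * u) - (y * v) ≡ u * (x - y) + y * (u - v)
    *-cong-≡ = solve-∀

  open CommutativeRing ℤ/p public
    using (setoid; commutativeSemiring; +-cong; *-cong; *-congˡ; *-congʳ; -‿cong)
    renaming (refl to ≈-refl; sym to ≈-sym; trans to ≈-trans)

  ≈0⇒∣ : ∀ {x} → x ≈ 0ℤ → p ℕ.∣ ∣ x ∣
  ≈0⇒∣ {x} (mod-p d) = Signed.∣⇒∣ᵤ (subst (+ p Signed.∣_) (ℤ.+-identityʳ x) d)

  ∣⇒≈0 : ∀ {x} → p ℕ.∣ ∣ x ∣ → x ≈ 0ℤ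
  ∣⇒≈0 {x} d = mod-p (subst (+ p Signed.∣_) (sym (ℤ.+-identityʳ x)) (Signed.∣ᵤ⇒∣ {+ p} {x} d))

  p≈0 : + p ≈ 0ℤ
  p≈0 = ∣⇒≈0 {+ p} ℕ.∣-refl

  toℕ-injective-≈ : ∀ {i j : Fin p} → + toℕ i ≈ + toℕ j → i ≡ j
  toℕ-injective-≈ {i} {j} eq = Fin.toℕ-injective $
    [ (λ i≤j → sym (ordered i≤j (≈-sym eq))) , (λ j≤i → ordered j≤i eq) ]′ (ℕ.≤-total (toℕ i) (toℕ j))
    where
    ordered : ∀ {i j : Fin p} → toℕ j ℕ.≤ toℕ i → + toℕ i ≈ + toℕ j → toℕ i ≡ toℕ j
    ordered {i} {j} j≤i eq = ℕ.≤-antisym (ℕ.m∸n≡0⇒m≤n (small _ p∣i∸j (ℕ.≤-<-trans (ℕ.m∸n≤m _ (toℕ j)) (Fin.toℕ<n i)))) j≤i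
      where
      p∣i∸j : p ℕ.∣ toℕ i ℕ.∸ toℕ j
      p∣i∸j = subst (λ x → p ℕ.∣ ∣ x ∣) (trans (ℤ.m-n≡m⊖n (toℕ i) (toℕ j)) (ℤ.⊖-≥ j≤i)) (≈⇒[mod] eq)
      small : ∀ n → p ℕ.∣ n → n ℕ.< p → n ≡ 0
      small zero    _ _   = refl
      small (suc n) d n<p = contradiction d (ℕ.>⇒∤ n<p)

  module _ .{{_ : ℕ.NonZero p}} where

    res : ℤ → Fin p
    res x = fromℕ< (n%ℕd<d x p)

    res-≈ : ∀ x → + toℕ (res x) ≈ x
    res-≈ x = mod-p (Signed.divides (- (x /ℕ p)) (begin
      + toℕ (res x) - x                           ≡⟨ cong (λ n → + n - x) (Fin.toℕ-fromℕ< (n%ℕd<d x p)) ⟩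
      + (x %ℕ p) - x                              ≡⟨ cong (_-_ (+ (x %ℕ p))) (a≡a%ℕn+[a/ℕn]*n x p) ⟩
      + (x %ℕ p) - (+ (x %ℕ p) + (x /ℕ p) * + p)  ≡⟨ cancel (+ (x %ℕ p)) (x /ℕ p) (+ p) ⟩
      - (x /ℕ p) * + p                            ∎))
      where
      open ≡-Reasoning
      cancel : ∀ r q p → r - (r + q * p) ≡ - q * p
      cancel = solve-∀

  module PrimeModulus (pr : Prime p) where
    instance _ = prime⇒nonZero pr

    ≈0-split : ∀ x y → x * y ≈ 0ℤ → x ≈ 0ℤ ⊎ y ≈ 0ℤ
    ≈0-split x y xy≈0 = Sum.map ∣⇒≈0 ∣⇒≈0
      (euclidsLemma ∣ x ∣ ∣ y ∣ pr (subst (p ℕ.∣_) (ℤ.abs-* x y) (≈0⇒∣ xy≈0)))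

    *-cancelˡ : ∀ z {x y} → ¬ z ≈ 0ℤ → z * x ≈ z * y → x ≈ y
    *-cancelˡ z {x} {y} z≉0 eq with ≈0-split z (x - y) (combine 1ℤ (factor z x y) eq)
      where
      factor : ∀ z x y → z * (x - y) - 0ℤ ≡ 1ℤ * (z * x - z * y)
      factor = solve-∀
    ... | inj₁ z≈0   = contradiction z≈0 z≉0
    ... | inj₂ x-y≈0 = combine 1ℤ (difference x y) x-y≈0
      where
      difference : ∀ x y → x - y ≡ 1ℤ * (x - y - 0ℤ)
      difference = solve-∀

    inverse : ∀ x → ¬ x ≈ 0ℤ → ∃ λ u → u * x ≈ 1ℤ
    inverse x x≉0 = let u , ur≈1 = bezout (coprime-Bézout (prime⇒coprime pr {{ℕ.≢-nonZero r≢0}} (Fin.toℕ<n (res x))))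
                    in u , ≈-trans (*-congˡ {u} (≈-sym (res-≈ x))) ur≈1
      where
      r = toℕ (res x)

      r≢0 : r ≢ 0
      r≢0 r≡0 = x≉0 (≈-trans (≈-sym (res-≈ x)) (≡⇒≈ (cong +_ r≡0)))

      -- Bézout over ℕ has two sign patterns, `1 + b r = a p` and `1 + a p = b r`; the inverse is
      -- `− b` in the first and `b` in the second.
      bezout : Bézout.Identity 1 p r → ∃ λ u → u * + r ≈ 1ℤ
      bezout (Bézout.+- a b eq) = - + b , combine (- + a) (begin
        - + b * + r - 1ℤ     ≡⟨ move (+ b) (+ r) ⟩
        - (1ℤ + + b * + r)   ≡⟨ cong (λ z → - (1ℤ + z)) (ℤ.pos-* b r) ⟨
        - + (1 ℕ.+ b ℕ.* r)  ≡⟨ cong (λ n → - + n) eq ⟩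
        - + (a ℕ.* p)        ≡⟨ cong -_ (ℤ.pos-* a p) ⟩
        - (+ a * + p)        ≡⟨ move′ (+ a) (+ p) ⟩
        - + a * (+ p - 0ℤ)   ∎) p≈0
        where
        open ≡-Reasoning
        move : ∀ b r → - b * r - 1ℤ ≡ - (1ℤ + b * r)
        move = solve-∀
        move′ : ∀ a p → - (a * p) ≡ - a * (p - 0ℤ)
        move′ = solve-∀
      bezout (Bézout.-+ a b eq) = + b , combine (+ a) (begin
        + b * + r - 1ℤ           ≡⟨ cong (_- 1ℤ) (ℤ.pos-* b r) ⟨
        + (b ℕ.* r) - 1ℤ         ≡⟨ cong (λ n → + n - 1ℤ) eq ⟨
        (1ℤ + + (a ℕ.* p)) - 1ℤ  ≡⟨ cong (λ z → (1ℤ + z) - 1ℤ) (ℤ.pos-* a p) ⟩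
        (1ℤ + + a * + p) - 1ℤ    ≡⟨ move (+ a) (+ p) ⟩
        + a * (+ p - 0ℤ)         ∎) p≈0
        where
        open ≡-Reasoning
        move : ∀ a p → (1ℤ + a * p) - 1ℤ ≡ a * (p - 0ℤ)
        move = solve-∀

    -- Makes `(2q)!` cancellable when `2^2q` is compared with `(−1)^q`.
    !≉0 : ∀ n → n ℕ.< p → ¬ + (n !) ≈ 0ℤ
    !≉0 zero    1<p eq = ℕ.>⇒∤ (ℕ.nonTrivial⇒n>1 p {{prime⇒nonTrivial pr}}) (≈0⇒∣ eq)
    !≉0 (suc n) n<p eq with ≈0-split (+ suc n) (+ (n !)) (≈-trans (≡⇒≈ (sym (ℤ.pos-* (suc n) (n !)))) eq)
    ... | inj₁ n≈0 = ℕ.>⇒∤ n<p (≈0⇒∣ n≈0)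
    ... | inj₂ !≈0 = !≉0 n (ℕ.<-trans (ℕ.n<1+n n) n<p) !≈0

    1≉-1 : 2 ℕ.< p → ¬ 1ℤ ≈ - 1ℤ
    1≉-1 2<p eq = ℕ.>⇒∤ 2<p (≈0⇒∣ {+ 2} (combine 1ℤ refl eq))

-- The quadratic character of 2 modulo p ≡ 5 (mod 8)

-- Splits off one even and one odd factor, in the form of the recursions for `evens` and `negOdds`.
[2k+2]! : ∀ k → + ((2 ℕ.* suc k) !) ≡ (+ 2 * + suc k) * ((1ℤ + + 2 * + k) * + ((2 ℕ.* k) !))
[2k+2]! k = begin
  + ((2 ℕ.* suc k) !)
    ≡⟨ cong (λ n → + (n !)) (ℕ.*-suc 2 k) ⟩
  + ((2 ℕ.+ 2 ℕ.* k) ℕ.* ((1 ℕ.+ 2 ℕ.* k) ℕ.* (2 ℕ.* k) !))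
    ≡⟨ ℤ.pos-* (2 ℕ.+ 2 ℕ.* k) ((1 ℕ.+ 2 ℕ.* k) ℕ.* (2 ℕ.* k) !) ⟩
  + (2 ℕ.+ 2 ℕ.* k) * + ((1 ℕ.+ 2 ℕ.* k) ℕ.* (2 ℕ.* k) !)
    ≡⟨ cong₂ _*_ (trans (cong +_ (sym (ℕ.*-suc 2 k))) (ℤ.pos-* 2 (suc k))) (ℤ.pos-* (1 ℕ.+ 2 ℕ.* k) ((2 ℕ.* k) !)) ⟩
  (+ 2 * + suc k) * ((1ℤ + + (2 ℕ.* k)) * + ((2 ℕ.* k) !))
    ≡⟨ cong (λ z → (+ 2 * + suc k) * ((1ℤ + z) * + ((2 ℕ.* k) !))) (ℤ.pos-* 2 k) ⟩
  (+ 2 * + suc k) * ((1ℤ + + 2 * + k) * + ((2 ℕ.* k) !))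
    ∎
  where open ≡-Reasoning

module QuadraticCharacterOf2 {p : ℕ} (pr : Prime p) where
  open Residues p
  open PrimeModulus pr
  open Exp commutativeSemiring
  open SetoidReasoning setoid

  -- The products `2 · 4 ⋯ 2k` and `(−1)(−3) ⋯ (−(2k − 1))`. The signs come from the shift by `p`,
  -- which turns an even number below `p` into a negative odd one.
  evens negOdds : ℕ → ℤ
  evens zero      = 1ℤ
  evens (suc k)   = (+ 2 * + suc k) * evens k
  negOdds zero    = 1ℤ
  negOdds (suc k) = - (1ℤ + + 2 * + k) * negOdds k

  evens≈2^k*k! : ∀ k → evens k ≈ (+ 2) ^ k * + (k !)
  evens≈2^k*k! zero    = ≈-refl
  evens≈2^k*k! (suc k) = begin
    (+ 2 * + suc k) * evens k                ≈⟨ *-congˡ {+ 2 * + suc k} (evens≈2^k*k! k) ⟩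
    (+ 2 * + suc k) * ((+ 2) ^ k * + (k !))  ≡⟨ swap (+ 2) (+ suc k) ((+ 2) ^ k) (+ (k !)) ⟩
    + 2 * (+ 2) ^ k * (+ suc k * + (k !))    ≡⟨ cong (+ 2 * (+ 2) ^ k *_) (ℤ.pos-* (suc k) (k !)) ⟨
    (+ 2) ^ suc k * + (suc k !)              ∎
    where
    swap : ∀ a b c d → (a * b) * (c * d) ≡ a * c * (b * d)
    swap = solve-∀

  -- The even and the odd numbers up to `2k` interleave to a factorial, and each odd one contributes
  -- a sign.
  evens*negOdds : ∀ k → evens k * negOdds k ≈ (- 1ℤ) ^ k * + ((2 ℕ.* k) !)
  evens*negOdds zero    = ≈-refl
  evens*negOdds (suc k) = begin
    (+ 2 * + suc k) * evens k * (- (1ℤ + + 2 * + k) * negOdds k)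
      ≡⟨ regroup (+ 2) (+ suc k) (+ k) (evens k) (negOdds k) ⟩
    - 1ℤ * ((+ 2 * + suc k) * (1ℤ + + 2 * + k)) * (evens k * negOdds k)
      ≈⟨ *-congˡ { - 1ℤ * ((+ 2 * + suc k) * (1ℤ + + 2 * + k))} (evens*negOdds k) ⟩
    - 1ℤ * ((+ 2 * + suc k) * (1ℤ + + 2 * + k)) * ((- 1ℤ) ^ k * + ((2 ℕ.* k) !))
      ≡⟨ regroup′ (+ 2 * + suc k) (1ℤ + + 2 * + k) ((- 1ℤ) ^ k) (+ ((2 ℕ.* k) !)) ⟩
    (- 1ℤ) ^ suc k * ((+ 2 * + suc k) * ((1ℤ + + 2 * + k) * + ((2 ℕ.* k) !)))
      ≡⟨ cong ((- 1ℤ) ^ suc k *_) ([2k+2]! k) ⟨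
    (- 1ℤ) ^ suc k * + ((2 ℕ.* suc k) !)
      ∎
    where
    regroup : ∀ t s k e o → (t * s) * e * (- (1ℤ + t * k) * o) ≡ - 1ℤ * ((t * s) * (1ℤ + t * k)) * (e * o)
    regroup = solve-∀
    regroup′ : ∀ a b c d → - 1ℤ * (a * b) * (c * d) ≡ (- 1ℤ * c) * (a * (b * d))
    regroup′ = solve-∀

  -- Replaces the k largest factors 2j, where a < j ≤ r = (p ∸ 1)/2, by the congruent −(p ∸ 2j).
  evens-fold : ∀ r → p ≡ 1 ℕ.+ 2 ℕ.* r → ∀ k a → a ℕ.+ k ≡ r → evens r ≈ evens a * negOdds k
  evens-fold r p≡1+2r zero    a a≡r   = ≡⇒≈ (trans (cong evens (trans (sym a≡r) (ℕ.+-identityʳ a))) (sym (ℤ.*-identityʳ _)))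
  evens-fold r p≡1+2r (suc k) a a+k≡r = begin
    evens r                                     ≈⟨ evens-fold r p≡1+2r k (suc a) (trans (sym (ℕ.+-suc a k)) a+k≡r) ⟩
    (+ 2 * + suc a) * evens a * negOdds k       ≈⟨ *-congʳ {negOdds k} (*-congʳ {evens a} 2[a+1]≈) ⟩
    - (1ℤ + + 2 * + k) * evens a * negOdds k    ≡⟨ swap (- (1ℤ + + 2 * + k)) (evens a) (negOdds k) ⟩
    evens a * (- (1ℤ + + 2 * + k) * negOdds k)  ∎
    where
    swap : ∀ a b c → a * b * c ≡ b * (a * c)
    swap = solve-∀
    p-value : + p ≡ 1ℤ + + 2 * (+ a + + suc k)
    p-value = trans (cong +_ p≡1+2r) (trans (cong (λ z → 1ℤ + z) (ℤ.pos-* 2 r)) (cong (λ n → 1ℤ + + 2 * + n) (sym a+k≡r)))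
    move : ∀ t a k → t * (1ℤ + a) - - (1ℤ + t * k) ≡ 1ℤ * (1ℤ + t * (a + (1ℤ + k)) - 0ℤ)
    move = solve-∀
    2[a+1]≈ : + 2 * + suc a ≈ - (1ℤ + + 2 * + k)
    2[a+1]≈ = combine 1ℤ (trans (move (+ 2) (+ a) (+ k)) (cong (λ z → 1ℤ * (z - 0ℤ)) (sym p-value))) p≈0

  -- With `r = 2q = (p − 1)/2`, both sides multiplied by `r!` are congruent to `2 · 4 ⋯ 2r`, and
  -- `r!` is invertible.
  2^2q≈[-1]^q : ∀ q → p ≡ 1 ℕ.+ 4 ℕ.* q → (+ 2) ^ (2 ℕ.* q) ≈ (- 1ℤ) ^ q
  2^2q≈[-1]^q q p≡1+4q = *-cancelˡ (+ (r !)) (!≉0 r r<p) (begin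
    + (r !) * (+ 2) ^ r   ≡⟨ ℤ.*-comm (+ (r !)) _ ⟩
    (+ 2) ^ r * + (r !)   ≈⟨ evens≈2^k*k! r ⟨
    -- Folding exactly half of the factors, `a = k = q`, leaves the evens up to `2q` beside the
    -- negated odds up to `2q − 1`, which recombine to `r!` up to sign.
    evens r               ≈⟨ evens-fold r p≡1+2r q q (cong (q ℕ.+_) (sym (ℕ.+-identityʳ q))) ⟩
    evens q * negOdds q   ≈⟨ evens*negOdds q ⟩
    (- 1ℤ) ^ q * + (r !)  ≡⟨ ℤ.*-comm _ (+ (r !)) ⟩
    + (r !) * (- 1ℤ) ^ q  ∎)
    where
    r = 2 ℕ.* q
    p≡1+2r : p ≡ 1 ℕ.+ 2 ℕ.* r
    p≡1+2r = trans p≡1+4q (cong suc (ℕ.*-assoc 2 2 q))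
    r<p : r ℕ.< p
    r<p = subst (r ℕ.<_) (sym p≡1+2r) (ℕ.s≤s (ℕ.m≤m+n r (r ℕ.+ 0)))

  1^ : ∀ k → 1ℤ ^ k ≈ 1ℤ
  1^ zero    = ≈-refl
  1^ (suc k) = ≈-trans (≡⇒≈ (ℤ.*-identityˡ (1ℤ ^ k))) (1^ k)

  [-1]^2k : ∀ k → (- 1ℤ) ^ (2 ℕ.* k) ≈ 1ℤ
  [-1]^2k k = begin
    (- 1ℤ) ^ (2 ℕ.* k)  ≈⟨ ^-assocʳ (- 1ℤ) 2 k ⟨
    ((- 1ℤ) ^ 2) ^ k    ≡⟨⟩
    1ℤ ^ k              ≈⟨ 1^ k ⟩
    1ℤ                  ∎

  private module SquareRootOf-1 (m : ℕ) (p≡5+8m : p ≡ 1 ℕ.+ 4 ℕ.* (1 ℕ.+ 2 ℕ.* m)) where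

    q : ℕ
    q = 1 ℕ.+ 2 ℕ.* m

    -- `q` is odd, which is what separates `p ≡ 5` from `p ≡ 1` modulo 8.
    [-1]^q≈-1 : (- 1ℤ) ^ q ≈ - 1ℤ
    [-1]^q≈-1 = *-congˡ { - 1ℤ} ([-1]^2k m)

    -- The sign makes (1 - c)^(2q) equal to 1; it is (1 + c)^(2q) for the other root of -1.
    c : ℤ
    c = (- 1ℤ) ^ m * (+ 2) ^ q

    square-* : ∀ a b → (a * b) * (a * b) ≡ (a * a) * (b * b)
    square-* = solve-∀

    [-1]^m-square : (- 1ℤ) ^ m * (- 1ℤ) ^ m ≈ 1ℤ
    [-1]^m-square = begin
      (- 1ℤ) ^ m * (- 1ℤ) ^ m  ≈⟨ ^-homo-* (- 1ℤ) m m ⟨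
      (- 1ℤ) ^ (m ℕ.+ m)       ≡⟨ cong (λ n → (- 1ℤ) ^ (m ℕ.+ n)) (ℕ.+-identityʳ m) ⟨
      (- 1ℤ) ^ (2 ℕ.* m)       ≈⟨ [-1]^2k m ⟩
      1ℤ                       ∎

    2^q-square : (+ 2) ^ q * (+ 2) ^ q ≈ - 1ℤ
    2^q-square = begin
      (+ 2) ^ q * (+ 2) ^ q  ≈⟨ ^-homo-* (+ 2) q q ⟨
      (+ 2) ^ (q ℕ.+ q)      ≡⟨ cong (λ n → (+ 2) ^ (q ℕ.+ n)) (ℕ.+-identityʳ q) ⟨
      (+ 2) ^ (2 ℕ.* q)      ≈⟨ 2^2q≈[-1]^q q p≡5+8m ⟩
      (- 1ℤ) ^ q             ≈⟨ [-1]^q≈-1 ⟩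
      - 1ℤ                   ∎

    c²≈-1 : c * c ≈ - 1ℤ
    c²≈-1 = begin
      c * c                                                ≡⟨ square-* ((- 1ℤ) ^ m) ((+ 2) ^ q) ⟩
      ((- 1ℤ) ^ m * (- 1ℤ) ^ m) * ((+ 2) ^ q * (+ 2) ^ q)  ≈⟨ *-cong [-1]^m-square 2^q-square ⟩
      - 1ℤ                                                 ∎

    -- Since `q = 1 + 2m`, `c^q = c (c²)^m ≡ c (−1)^m`, and this sign cancels the one built into
    -- `c`.
    c^q≈2^q : c ^ q ≈ (+ 2) ^ q
    c^q≈2^q = begin
      c * c ^ (2 ℕ.* m)                    ≈⟨ *-congˡ {c} (^-assocʳ c 2 m) ⟨
      c * (c ^ 2) ^ m                      ≈⟨ *-congˡ {c} (^-congˡ m (≈-trans (≡⇒≈ (cong (c *_) (ℤ.*-identityʳ c))) c²≈-1)) ⟩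
      c * (- 1ℤ) ^ m                       ≡⟨ regroup ((- 1ℤ) ^ m) ((+ 2) ^ q) ⟩
      (- 1ℤ) ^ m * (- 1ℤ) ^ m * (+ 2) ^ q  ≈⟨ *-congʳ {(+ 2) ^ q} [-1]^m-square ⟩
      1ℤ * (+ 2) ^ q                       ≡⟨ ℤ.*-identityˡ _ ⟩
      (+ 2) ^ q                            ∎
      where
      regroup : ∀ a b → (a * b) * a ≡ a * a * b
      regroup = solve-∀

    -- Handles `1 − c` and `1 + c` together. As `s² ≡ 1` and `c² ≡ −1`, the square of `1 + s c` is
    -- `2 s c`, whose `q`-th power is `s^q 2^q c^q ≡ s^q 2^2q`.
    power-2q : ∀ s → s * s ≈ 1ℤ → (1ℤ + s * c) ^ (2 ℕ.* q) ≈ - (s ^ q)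
    power-2q s s²≈1 = begin
      (1ℤ + s * c) ^ (2 ℕ.* q)         ≈⟨ ^-assocʳ (1ℤ + s * c) 2 q ⟨
      ((1ℤ + s * c) ^ 2) ^ q           ≈⟨ ^-congˡ q square ⟩
      (s * (+ 2 * c)) ^ q              ≈⟨ ^-distrib-* s (+ 2 * c) q ⟩
      s ^ q * (+ 2 * c) ^ q            ≈⟨ *-congˡ {s ^ q} (^-distrib-* (+ 2) c q) ⟩
      s ^ q * ((+ 2) ^ q * c ^ q)      ≈⟨ *-congˡ {s ^ q} (*-congˡ {(+ 2) ^ q} c^q≈2^q) ⟩
      s ^ q * ((+ 2) ^ q * (+ 2) ^ q)  ≈⟨ *-congˡ {s ^ q} 2^q-square ⟩
      s ^ q * - 1ℤ                     ≡⟨ negate (s ^ q) ⟩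
      - (s ^ q)                        ∎
      where
      negate : ∀ x → x * - 1ℤ ≡ - x
      negate = solve-∀
      expand : ∀ s c → (1ℤ + s * c) * ((1ℤ + s * c) * 1ℤ) - s * ((1ℤ + 1ℤ) * c) ≡
               (c * c) * (s * s - 1ℤ) + 1ℤ * (c * c - - 1ℤ)
      expand = solve-∀
      square : (1ℤ + s * c) ^ 2 ≈ s * (+ 2 * c)
      square = combine₂ (c * c) 1ℤ (expand s c) s²≈1 c²≈-1

    [1-c]^2q≈1 : (1ℤ - c) ^ (2 ℕ.* q) ≈ 1ℤ
    [1-c]^2q≈1 = begin
      (1ℤ - c) ^ (2 ℕ.* q)         ≡⟨ cong (λ z → (1ℤ + z) ^ (2 ℕ.* q)) (ℤ.-1*i≡-i c) ⟨
      (1ℤ + - 1ℤ * c) ^ (2 ℕ.* q)  ≈⟨ power-2q (- 1ℤ) ≈-refl ⟩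
      - ((- 1ℤ) ^ q)               ≈⟨ -‿cong [-1]^q≈-1 ⟩
      1ℤ                           ∎

    [1+c]^2q≈-1 : (1ℤ + c) ^ (2 ℕ.* q) ≈ - 1ℤ
    [1+c]^2q≈-1 = begin
      (1ℤ + c) ^ (2 ℕ.* q)       ≡⟨ cong (λ z → (1ℤ + z) ^ (2 ℕ.* q)) (ℤ.*-identityˡ c) ⟨
      (1ℤ + 1ℤ * c) ^ (2 ℕ.* q)  ≈⟨ power-2q 1ℤ ≈-refl ⟩
      - (1ℤ ^ q)                 ≈⟨ -‿cong (1^ q) ⟩
      - 1ℤ                       ∎

  square-root-of--1 : ∀ m → p ≡ 1 ℕ.+ 4 ℕ.* (1 ℕ.+ 2 ℕ.* m) → ∃ λ c →
    c * c ≈ - 1ℤ ×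
    (1ℤ - c) ^ (2 ℕ.* (1 ℕ.+ 2 ℕ.* m)) ≈ 1ℤ ×
    (1ℤ + c) ^ (2 ℕ.* (1 ℕ.+ 2 ℕ.* m)) ≈ - 1ℤ
  square-root-of--1 m p≡5+8m = c , c²≈-1 , [1-c]^2q≈1 , [1+c]^2q≈-1
    where open SquareRootOf-1 m p≡5+8m

-- Orbits of the sub-add move

open FunctionalDigraphs
open SquaresPlusOne

act : Mat₂ → Vector ℤ 2 → Vector ℤ 2
act A v i = A i 0F * v 0F + A i 1F * v 1F

act-⊗ : ∀ A B v i → act (A ⊗ B) v i ≡ act A (act B v) i
act-⊗ A B v i = expand (A i 0F) (A i 1F) (B 0F 0F) (B 0F 1F) (B 1F 0F) (B 1F 1F) (v 0F) (v 1F)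
  where
  expand : ∀ a b c d e f x y → (a * c + b * e) * x + (a * d + b * f) * y ≡ a * (c * x + d * y) + b * (e * x + f * y)
  expand = solve-∀

act-I : ∀ v i → act I₂ v i ≡ v i
act-I v 0F = expand (v 0F) (v 1F)
  where
  expand : ∀ x y → 1ℤ * x + 0ℤ * y ≡ x
  expand = solve-∀
act-I v 1F = expand (v 0F) (v 1F)
  where
  expand : ∀ x y → 0ℤ * x + 1ℤ * y ≡ y
  expand = solve-∀

-- Left multiplication by `M` preserves the form `[[a, −b], [b, a]]`, the matrix of multiplication
-- by `a + bi`.
M^-complex : ∀ n → (M ^ᴹ n) 1F 1F ≡ (M ^ᴹ n) 0F 0F × (M ^ᴹ n) 0F 1F ≡ - (M ^ᴹ n) 1F 0F
M^-complex zero    = refl , refl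
M^-complex (suc n) with eq₁ , eq₂ ← M^-complex n rewrite eq₁ | eq₂ =
  diagonal ((M ^ᴹ n) 0F 0F) ((M ^ᴹ n) 1F 0F) , off-diagonal ((M ^ᴹ n) 0F 0F) ((M ^ᴹ n) 1F 0F)
  where
  diagonal : ∀ a b → 1ℤ * - b + 1ℤ * a ≡ 1ℤ * a + - 1ℤ * b
  diagonal = solve-∀
  off-diagonal : ∀ a b → 1ℤ * - b + - 1ℤ * a ≡ - (1ℤ * a + 1ℤ * b)
  off-diagonal = solve-∀

module SubAdd {p : ℕ} .{{_ : ℕ.NonZero p}} where
  open Residues p
  open Exp commutativeSemiring
  open SetoidReasoning setoid

  T : Vertex p → Vertex p
  T (a , b) = res (+ toℕ a - + toℕ b) , res (+ toℕ a + + toℕ b)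

  arc : ∀ u → ΓArc p u (T u)
  arc (a , b) = ≈⇒[mod] (res-≈ (+ toℕ a - + toℕ b)) , ≈⇒[mod] (res-≈ (+ toℕ a + + toℕ b))

  arc⇒≡ : ∀ u w → ΓArc p u w → T u ≡ w
  arc⇒≡ (a , b) (c , d) (c≡ , d≡) = cong₂ _,_
    (toℕ-injective-≈ (≈-trans (res-≈ _) (≈-sym ([mod]⇒≈ {+ toℕ c} {+ toℕ a - + toℕ b} c≡))))
    (toℕ-injective-≈ (≈-trans (res-≈ _) (≈-sym ([mod]⇒≈ {+ toℕ d} {+ toℕ a + + toℕ b} d≡))))

  -- Coordinates are lifted to ℤ so that integer powers of `M` act on them; reduction modulo `p` is
  -- left to `_≈_`.
  ⟦_⟧ : Vertex p → Vector ℤ 2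
  ⟦ a , b ⟧ = + toℕ a ∷ + toℕ b ∷ []

  ⟦⟧-injective : ∀ {u v} → (∀ i → ⟦ u ⟧ i ≈ ⟦ v ⟧ i) → u ≡ v
  ⟦⟧-injective eq = cong₂ _,_ (toℕ-injective-≈ (eq 0F)) (toℕ-injective-≈ (eq 1F))

  act-cong : ∀ A {v w} → (∀ i → v i ≈ w i) → ∀ i → act A v i ≈ act A w i
  act-cong A eq i = +-cong (*-congˡ {A i 0F} (eq 0F)) (*-congˡ {A i 1F} (eq 1F))

  ⟦T⟧ : ∀ u i → ⟦ T u ⟧ i ≈ act M ⟦ u ⟧ i
  ⟦T⟧ (a , b) 0F = ≈-trans (res-≈ _) (≡⇒≈ (expand (+ toℕ a) (+ toℕ b)))
    where
    expand : ∀ a b → a - b ≡ 1ℤ * a + - 1ℤ * b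
    expand = solve-∀
  ⟦T⟧ (a , b) 1F = ≈-trans (res-≈ _) (≡⇒≈ (expand (+ toℕ a) (+ toℕ b)))
    where
    expand : ∀ a b → a + b ≡ 1ℤ * a + 1ℤ * b
    expand = solve-∀

  ⟦fold-T⟧ : ∀ v n i → ⟦ fold v T n ⟧ i ≈ act (M ^ᴹ n) ⟦ v ⟧ i
  ⟦fold-T⟧ v zero    i = ≡⇒≈ (sym (act-I ⟦ v ⟧ i))
  ⟦fold-T⟧ v (suc n) i = begin
    ⟦ T (fold v T n) ⟧ i          ≈⟨ ⟦T⟧ (fold v T n) i ⟩
    act M ⟦ fold v T n ⟧ i        ≈⟨ act-cong M (⟦fold-T⟧ v n) i ⟩
    act M (act (M ^ᴹ n) ⟦ v ⟧) i  ≡⟨ act-⊗ M (M ^ᴹ n) ⟦ v ⟧ i ⟨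
    act (M ^ᴹ suc n) ⟦ v ⟧ i      ∎

  fixed⇒period : ∀ {v} n → (∀ i → act (M ^ᴹ n) ⟦ v ⟧ i ≈ ⟦ v ⟧ i) → fold v T n ≡ v
  fixed⇒period {v} n eq = ⟦⟧-injective λ i → ≈-trans (⟦fold-T⟧ v n i) (eq i)

  period⇒fixed : ∀ {v} n → fold v T n ≡ v → ∀ i → act (M ^ᴹ n) ⟦ v ⟧ i ≈ ⟦ v ⟧ i
  period⇒fixed {v} n eq i = ≈-trans (≈-sym (⟦fold-T⟧ v n i)) (≡⇒≈ (cong (λ u → ⟦ u ⟧ i) eq))

  act-≡I : ∀ {A} → A ≡ᴹ I₂ [mod p ] → ∀ v i → act A v i ≈ v i
  act-≡I {A} A≡I v i = ≈-trans
    (+-cong (*-congʳ {v 0F} ([mod]⇒≈ {A i 0F} (A≡I i 0F))) (*-congʳ {v 1F} ([mod]⇒≈ {A i 1F} (A≡I i 1F))))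
    (≡⇒≈ (act-I v i))

  M^≡I⇒period : ∀ {n} → M ^ᴹ n ≡ᴹ I₂ [mod p ] → ∀ v → fold v T n ≡ v
  M^≡I⇒period {n} M^≡I v = fixed⇒period n (act-≡I {M ^ᴹ n} M^≡I ⟦ v ⟧)

  -- `M (1, c) = (1 − c, 1 + c)`, and `c (1 − c) ≡ c + 1` as `c² ≡ −1`. Asking only for
  -- `w 1F ≈ c * w 0F` admits the reduced coordinates of a vertex.
  act-M^-eigenvector : ∀ {c w} → c * c ≈ - 1ℤ → w 1F ≈ c * w 0F → ∀ n i →
                       act (M ^ᴹ n) w i ≈ (1ℤ - c) ^ n * w i
  act-M^-eigenvector {c} {w} c²≈-1 w₁≈cw₀ zero    i = ≡⇒≈ (trans (act-I w i) (sym (ℤ.*-identityˡ (w i))))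
  act-M^-eigenvector {c} {w} c²≈-1 w₁≈cw₀ (suc n) i = begin
    act (M ^ᴹ suc n) w i                ≡⟨ act-⊗ M (M ^ᴹ n) w i ⟩
    act M (act (M ^ᴹ n) w) i            ≈⟨ act-cong M (act-M^-eigenvector {c} {w} c²≈-1 w₁≈cw₀ n) i ⟩
    act M (λ j → (1ℤ - c) ^ n * w j) i  ≈⟨ step ((1ℤ - c) ^ n) i ⟩
    (1ℤ - c) ^ suc n * w i              ∎
    where
    difference₀ : ∀ m c x y → (1ℤ * (m * x) + - 1ℤ * (m * y)) - (1ℤ - c) * m * x ≡ - m * (y - c * x)
    difference₀ = solve-∀
    difference₁ : ∀ m c x y → (1ℤ * (m * x) + 1ℤ * (m * y)) - (1ℤ - c) * m * y ≡
                  (c * m) * (y - c * x) + (m * x) * (c * c - - 1ℤ)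
    difference₁ = solve-∀
    step : ∀ m i → act M (λ j → m * w j) i ≈ (1ℤ - c) * m * w i
    step m 0F = combine (- m) (difference₀ m c (w 0F) (w 1F)) w₁≈cw₀
    step m 1F = combine₂ (c * m) (m * w 0F) (difference₁ m c (w 0F) (w 1F)) w₁≈cw₀ c²≈-1

module _ {p : ℕ} (pr : Prime p) where
  open Residues p
  open PrimeModulus pr
  private instance
    p≢0 = prime⇒nonZero pr
  open SubAdd {p}
  open Exp commutativeSemiring
  open SetoidReasoning setoid

  -- Cycle lengths for primes p ≡ 3 (mod 4)

  module _ (p≡3[4] : p % 4 ≡ 3) where

    -- Otherwise `y` has an inverse `u`, and `1 + (u x)² ≡ u² (x² + y²) ≡ 0`. The descent is over ℕ,
    -- so `u x` is replaced by its representative `t`.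
    x²+y²≈0⇒y≈0 : ∀ x y → x * x + y * y ≈ 0ℤ → y ≈ 0ℤ
    x²+y²≈0⇒y≈0 x y x²+y²≈0 with y ≈? 0ℤ
    ... | yes y≈0 = y≈0
    ... | no  y≉0 = contradiction (≈0⇒∣ 1+t²≈0) (n≡3[4]⇒n∤1+x² p p≡3[4] t)
      where
      u = proj₁ (inverse y y≉0)
      uy≈1 = proj₂ (inverse y y≉0)
      t = toℕ (res (u * x))
      difference : ∀ u x y → 1ℤ + (u * x) * (u * x) - 0ℤ ≡
                   (u * u) * (x * x + y * y - 0ℤ) + - (1ℤ + u * y) * (u * y - 1ℤ)
      difference = solve-∀
      1+t²≈0 : + (1 ℕ.+ t ℕ.* t) ≈ 0ℤ
      1+t²≈0 = begin
        + (1 ℕ.+ t ℕ.* t)       ≡⟨ cong (λ z → 1ℤ + z) (ℤ.pos-* t t) ⟩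
        1ℤ + + t * + t          ≈⟨ +-cong (≈-refl {1ℤ}) (*-cong (res-≈ (u * x)) (res-≈ (u * x))) ⟩
        1ℤ + (u * x) * (u * x)  ≈⟨ combine₂ (u * u) (- (1ℤ + u * y)) (difference u x y) x²+y²≈0 uy≈1 ⟩
        0ℤ                      ∎

    x²+y²≈0⇒x≈0 : ∀ x y → x * x + y * y ≈ 0ℤ → x ≈ 0ℤ
    x²+y²≈0⇒x≈0 x y eq = x²+y²≈0⇒y≈0 y x (≈-trans (≡⇒≈ (ℤ.+-comm (y * y) (x * x))) eq)

    zero-fixed : ∀ {v} → (∀ i → ⟦ v ⟧ i ≈ 0ℤ) → T v ≡ v
    zero-fixed {v} v≈0 = fixed⇒period 1 λ i → ≈-trans (act-cong (M ^ᴹ 1) {⟦ v ⟧} {λ _ → 0ℤ} v≈0 i)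
      (≈-trans (≡⇒≈ (vanish ((M ^ᴹ 1) i 0F) ((M ^ᴹ 1) i 1F))) (≈-sym (v≈0 i)))
      where
      vanish : ∀ a b → a * 0ℤ + b * 0ℤ ≡ 0ℤ
      vanish = solve-∀

    period⇒M^≡I : ∀ {v} n → T v ≢ v → fold v T n ≡ v → M ^ᴹ n ≡ᴹ I₂ [mod p ]
    period⇒M^≡I {v} n Tv≢v per = M^≡I
      where
      a = (M ^ᴹ n) 0F 0F
      b = (M ^ᴹ n) 1F 0F
      x = ⟦ v ⟧ 0F
      y = ⟦ v ⟧ 1F
      norm = (a - 1ℤ) * (a - 1ℤ) + b * b

      row₀ : a * x + - b * y ≈ x
      row₀ = subst (λ z → a * x + z * y ≈ x) (proj₂ (M^-complex n)) (period⇒fixed n per 0F)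
      row₁ : b * x + a * y ≈ y
      row₁ = subst (λ z → b * x + z * y ≈ y) (proj₁ (M^-complex n)) (period⇒fixed n per 1F)

      -- Both identities multiply `(M^n − I) v` by the adjugate of `M^n − I`, whose determinant is
      -- `norm`. Thus `norm` kills both coordinates of `v`, and it vanishes unless `v` is the
      -- origin, which `T` fixes.
      elim-y : ∀ a b x y → ((a - 1ℤ) * (a - 1ℤ) + b * b) * x - 0ℤ ≡
               (a - 1ℤ) * ((a * x + - b * y) - x) + b * ((b * x + a * y) - y)
      elim-y = solve-∀
      elim-x : ∀ a b x y → ((a - 1ℤ) * (a - 1ℤ) + b * b) * y - 0ℤ ≡
               - b * ((a * x + - b * y) - x) + (a - 1ℤ) * ((b * x + a * y) - y)
      elim-x = solve-∀

      norm≈0 : norm ≈ 0ℤ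
      norm≈0 =
        [ id , (λ x≈0 →
        [ id , (λ y≈0 → contradiction (zero-fixed λ { 0F → x≈0 ; 1F → y≈0 }) Tv≢v) ]′
        (≈0-split norm y (combine₂ (- b) (a - 1ℤ) (elim-x a b x y) row₀ row₁))) ]′
        (≈0-split norm x (combine₂ (a - 1ℤ) b (elim-y a b x y) row₀ row₁))

      b≈0 : b ≈ 0ℤ
      b≈0 = x²+y²≈0⇒y≈0 (a - 1ℤ) b norm≈0

      a≈1 : a ≈ 1ℤ
      a≈1 = combine 1ℤ (shift a) (x²+y²≈0⇒x≈0 (a - 1ℤ) b norm≈0)
        where
        shift : ∀ a → a - 1ℤ ≡ 1ℤ * (a - 1ℤ - 0ℤ)
        shift = solve-∀

      M^≡I : M ^ᴹ n ≡ᴹ I₂ [mod p ]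
      M^≡I 0F 0F = ≈⇒[mod] a≈1
      M^≡I 0F 1F = ≈⇒[mod] (≈-trans (≡⇒≈ (proj₂ (M^-complex n))) (-‿cong b≈0))
      M^≡I 1F 0F = ≈⇒[mod] b≈0
      M^≡I 1F 1F = ≈⇒[mod] (≈-trans (≡⇒≈ (proj₁ (M^-complex n))) a≈1)

    ¬secondary : ¬ HasSecondaryCycle p
    ¬secondary (ℓ , C , ¬primary , ℓ≢1) = ¬primary record
      { positive = positive
      -- If `T` fixed the start vertex, minimality would give `ℓ ≤ 1`, against `ℓ ≢ 1`.
      ; power≡I  = period⇒M^≡I ℓ (λ Tv≡v → ℓ≢1 (ℕ.≤-antisym (minimal 1 (ℕ.s≤s ℕ.z≤n) Tv≡v) positive)) period
      ; least    = λ j 0<j M^j≡I → minimal j 0<j (M^≡I⇒period {j} M^j≡I _)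
      }
      where open MinimalPeriod (cycle⇒minimalPeriod arc⇒≡ arc C)

  -- A secondary cycle through an eigenvector of M

  module _ (c : ℤ) (n : ℕ) (2<p : 2 ℕ.< p) (0<n : 0 ℕ.< n) (c²≈-1 : c * c ≈ - 1ℤ)
           ([1-c]^n≈1 : (1ℤ - c) ^ n ≈ 1ℤ) ([1+c]^n≈-1 : (1ℤ + c) ^ n ≈ - 1ℤ) where

    eigenvector : ℤ → Vertex p
    eigenvector e = res 1ℤ , res e

    act-eigenvector : ∀ e → e * e ≈ - 1ℤ → ∀ n i →
                      act (M ^ᴹ n) ⟦ eigenvector e ⟧ i ≈ (1ℤ - e) ^ n * ⟦ eigenvector e ⟧ i
    act-eigenvector e e²≈-1 = act-M^-eigenvector {e} {⟦ eigenvector e ⟧} e²≈-1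
      (≈-trans (res-≈ e) (≈-trans (≡⇒≈ (sym (ℤ.*-identityʳ e))) (*-congˡ {e} (≈-sym (res-≈ 1ℤ)))))

    eigenvalue≈1⇒period : ∀ e → e * e ≈ - 1ℤ → ∀ n → (1ℤ - e) ^ n ≈ 1ℤ →
                          fold (eigenvector e) T n ≡ eigenvector e
    eigenvalue≈1⇒period e e²≈-1 n ≈1 = fixed⇒period n λ i → ≈-trans (act-eigenvector e e²≈-1 n i)
      (≈-trans (*-congʳ {⟦ eigenvector e ⟧ i} ≈1) (≡⇒≈ (ℤ.*-identityˡ (⟦ eigenvector e ⟧ i))))

    -- The first coordinate of the eigenvector represents 1, so comparing first coordinates isolates
    -- the power of the eigenvalue.
    period⇒eigenvalue≈1 : ∀ e → e * e ≈ - 1ℤ → ∀ n → fold (eigenvector e) T n ≡ eigenvector e →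
                          (1ℤ - e) ^ n ≈ 1ℤ
    period⇒eigenvalue≈1 e e²≈-1 n per = begin
      (1ℤ - e) ^ n                         ≡⟨ ℤ.*-identityʳ _ ⟨
      (1ℤ - e) ^ n * 1ℤ                    ≈⟨ *-congˡ {(1ℤ - e) ^ n} (res-≈ 1ℤ) ⟨
      (1ℤ - e) ^ n * ⟦ eigenvector e ⟧ 0F  ≈⟨ act-eigenvector e e²≈-1 n 0F ⟨
      act (M ^ᴹ n) ⟦ eigenvector e ⟧ 0F    ≈⟨ period⇒fixed n per 0F ⟩
      ⟦ eigenvector e ⟧ 0F                 ≈⟨ res-≈ 1ℤ ⟩
      1ℤ                                   ∎

    [-c]²≈-1 : - c * - c ≈ - 1ℤ
    [-c]²≈-1 = ≈-trans (≡⇒≈ (square-neg c)) c²≈-1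
      where
      square-neg : ∀ c → - c * - c ≡ c * c
      square-neg = solve-∀

    returns : fold (eigenvector c) T n ≡ eigenvector c
    returns = eigenvalue≈1⇒period c c²≈-1 n [1-c]^n≈1

    -- A fixed eigenvector would have eigenvalue `1 − c ≡ 1`, so `c ≡ 0` against `c² ≡ −1`; the
    -- clash is brought into the form `1 ≈ - 1`.
    orbit-length≢1 : ∀ {ℓ} → MinimalPeriod T (eigenvector c) ℓ → ℓ ≢ 1
    orbit-length≢1 mp refl = 1≉-1 2<p (combine₂ (c + c) (1ℤ + 1ℤ) (difference c) 1-c≈1 c²≈-1)
      where
      1-c≈1 : (1ℤ - c) ^ 1 ≈ 1ℤ
      1-c≈1 = period⇒eigenvalue≈1 c c²≈-1 1 (MinimalPeriod.period mp)
      difference : ∀ c → 1ℤ - - 1ℤ ≡ (c + c) * ((1ℤ - c) * 1ℤ - 1ℤ) + (1ℤ + 1ℤ) * (c * c - - 1ℤ)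
      difference = solve-∀

    -- If the order of `M` divided `n`, the other eigenvector `(1, −c)` would return after `n` moves
    -- too, but the `n`-th power of its eigenvalue `1 + c` is `−1`.
    ∣n⇒¬primary : ∀ {ℓ} → ℓ ∣ n → ¬ PrimaryLength p ℓ
    ∣n⇒¬primary {ℓ} (divides k n≡kℓ) order = 1≉-1 2<p (begin
      1ℤ              ≈⟨ period⇒eigenvalue≈1 (- c) [-c]²≈-1 n u-returns ⟨
      (1ℤ - - c) ^ n  ≡⟨ cong (λ z → (1ℤ + z) ^ n) (ℤ.neg-involutive c) ⟩
      (1ℤ + c) ^ n    ≈⟨ [1+c]^n≈-1 ⟩
      - 1ℤ            ∎)
      where
      u = eigenvector (- c)
      u-returns : fold u T n ≡ u
      u-returns = subst (λ j → fold u T j ≡ u) (sym n≡kℓ)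
        (fold-multiple k (M^≡I⇒period {ℓ} (IsOrder.power≡I order) u))

    secondary : HasSecondaryCycle p
    secondary = from-orbit (minimalPeriod-exists (≡-dec Fin._≟_ Fin._≟_) n 0<n returns)
      where
      from-orbit : ∃ (MinimalPeriod T (eigenvector c)) → HasSecondaryCycle p
      from-orbit (ℓ , mp) = ℓ , minimalPeriod⇒cycle arc⇒≡ arc mp ,
        ∣n⇒¬primary (minimalPeriod-∣ mp returns) , orbit-length≢1 mp

%8⇒%4 : ∀ p {r} → p % 8 ≡ r → p % 4 ≡ r % 4
%8⇒%4 p p%8≡r = trans (sym (m∣n⇒o%n%m≡o%m 4 8 p (divides 2 refl))) (cong (_% 4) p%8≡r)

p≡5[8] : ∀ p → p % 8 ≡ 5 → p ≡ 1 ℕ.+ 4 ℕ.* (1 ℕ.+ 2 ℕ.* (p / 8))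
p≡5[8] p p%8≡5 = trans (m≡m%n+[m/n]*n p 8) (trans (cong (ℕ._+ p / 8 ℕ.* 8) p%8≡5) (rearrange (p / 8)))
  where
  rearrange : ∀ m → 5 ℕ.+ m ℕ.* 8 ≡ 1 ℕ.+ 4 ℕ.* (1 ℕ.+ 2 ℕ.* m)
  rearrange = ℕSolver.solve-∀

theorem7p4 : ∀ (p : ℕ) → Prime p → ¬ (2 ∣ p) →
    ((p % 8 ≡ 3 ⊎ p % 8 ≡ 7) → ¬ HasSecondaryCycle p) ×
    (p % 8 ≡ 5 → HasSecondaryCycle p)
theorem7p4 p pr _ =
  (λ p≡3∨7 → ¬secondary pr ([ %8⇒%4 p , %8⇒%4 p ]′ p≡3∨7)) ,
  -- The exponent is `2q = (p − 1)/2`, with `q = 1 + 2 (p / 8)`.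
  (λ p≡5 → eigenvalue-gap⇒secondary (2 ℕ.* (1 ℕ.+ 2 ℕ.* (p / 8))) (2<p p≡5) (ℕ.s≤s ℕ.z≤n)
           (square-root-of--1 pr (p / 8) (p≡5[8] p p≡5)))
  where
  open Residues p
  open Exp commutativeSemiring
  open QuadraticCharacterOf2

  2<p : p % 8 ≡ 5 → 2 ℕ.< p
  2<p p≡5 = ℕ.<-≤-trans (ℕ.s≤s (ℕ.s≤s (ℕ.s≤s ℕ.z≤n))) (subst (ℕ._≤ p) p≡5 (m%n≤m p 8))

  eigenvalue-gap⇒secondary : ∀ n → 2 ℕ.< p → 0 ℕ.< n →
    (∃ λ c → c * c ≈ - 1ℤ × (1ℤ - c) ^ n ≈ 1ℤ × (1ℤ + c) ^ n ≈ - 1ℤ) → HasSecondaryCycle p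
  eigenvalue-gap⇒secondary n 2<p 0<n (c , c²≈-1 , [1-c]^n≈1 , [1+c]^n≈-1) =
    secondary pr c n 2<p 0<n c²≈-1 [1-c]^n≈1 [1+c]^n≈-1
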